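{- Let $G$ be a finite connected graph with $n$ vertices. For the all-singleton oriented partition of $G$ (each edge is its own class, with a chosen direction), $\Gamma_{\mathrm{univ}}\cong\mathbb{Z}^{\,n-1}$ and the quotient labeling $\phi$ is isometric on all pairs, with the infinite host $\mathrm{Cay}(\mathbb{Z}^{\,n-1},S\cup -S)$: $d_{\mathrm{Cay}}(\phi(u),\phi(v))=d_G(u,v)$ for all $u,v\in V(G)$.
   Context: $d_G$ is the shortest-path metric. An oriented partition of $G$ is a partition $\{F_1,\dots,F_t\}$ of $E(G)$ together with a chosen (forward) direction for each edge. Fix a cycle basis $B_1,\dots,B_c$ of $G$ whose signed edge-incidence vectors form a $\mathbb{Z}$-basis of the integer cycle lattice (the kernel of $\mathbb{Z}^E\to\mathbb{Z}^V$, $(u\to v)\mapsto\delta_v-\delta_u$). The signed cycle–class matrix $A\in\mathbb{Z}^{c\times t}$ has $A[i,j]$ equal to the net signed number of crossings of $F_j$ by $B_i$ (forward $+1$, backward $-1$). The universal group is $\Gamma_{\mathrm{univ}}=\mathbb{Z}^t/\mathrm{rowlattice}(A)$, $g_j$ is the image of the $j$-th standard basis vector, and the quotient labeling is $\phi(v)=\sum_{e\in P(r,v)}\pm g_{\mathrm{class}(e)}$ along any path from a fixed root $r$ to $v$ (sign $+$ for forward traversal, $-$ for backward; path-independent), where $\mathrm{class}(e)=j$ if $e\in F_j$. $S$ is the set of nonzero $g_j$; $\mathrm{Cay}(\Gamma,S\cup -S)$ is the graph on $\Gamma$ with edges $\{h,h+s\}$, $s\in S\cup -S$, and $d_{\mathrm{Cay}}$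 is its graph metric. -}

module Defs where

open import Level using (0ℓ)
open import Algebra.Bundles using (AbelianGroup)
open import Algebra.Morphism.Structures using (module GroupMorphisms)
import Algebra.Construct.Pointwise as Pointwise
import Algebra.Properties.Semiring.Sum as SemiringSum
open import Data.Bool using (if_then_else_)
open import Data.Fin using (Fin; zero; suc; _≟_)
open import Data.Integer using (ℤ; 0ℤ; 1ℤ; _+_; _-_; _*_; -_)
import Data.Integer.Properties as ℤ
open import Data.Integer.Solver using (module +-*-Solver)
open import Data.List using (List; []; _∷_)
open import Data.List.Relation.Unary.Unique.Propositional using (Unique)
open import Data.Nat using (ℕ; zero; suc; _≤_)
open import Data.Product using (∃; ∃-syntax; _×_; _,_; proj₁; proj₂)
open import Data.Sign using (Sign)
open import Data.Sum using (_⊎_; inj₁; inj₂)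
open import Function using (_∘_; id)
open import Function.Definitions using (StrictlySurjective)
open import Relation.Binary using (Rel)
open import Relation.Binary.PropositionalEquality
open import Relation.Nullary using (¬_; does; yes; no; contradiction)
open import Relation.Unary using (Pred; _∪_)

open SemiringSum ℤ.+-*-semiring public
  using (sum; sum-syntax; sum-cong-≗; ∑-distrib-+; ∑-comm; *-distribˡ-sum;
         *-distribʳ-sum; sum-replicate-zero)

-- Vertices are taken up to _≈_, so that vertices may be elements of a
-- quotient group.
data Reach {V : Set} (_≈_ _~_ : Rel V 0ℓ) : V → V → ℕ → Set where
  here : ∀ {u v} → u ≈ v → Reach _≈_ _~_ u v 0
  step : ∀ {u v w k} → u ~ v → Reach _≈_ _~_ v w k →
         Reach _≈_ _~_ u w (suc k)

-- A relation rather than a function: in an infinite graph the minimum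
-- cannot be computed in general.
IsDistance : {V : Set} (_≈_ _~_ : Rel V 0ℓ) → V → V → ℕ → Set
IsDistance _≈_ _~_ u v d =
  Reach _≈_ _~_ u v d × (∀ k → Reach _≈_ _~_ u v k → d ≤ k)

ℤ^_ : ℕ → AbelianGroup 0ℓ 0ℓ
ℤ^ k = Pointwise.abelianGroup (Fin k) ℤ.+-0-abelianGroup

δ : ∀ {k} → Fin k → Fin k → ℤ
δ i j = if does (i ≟ j) then 1ℤ else 0ℤ

combination : ∀ {c k} → (Fin c → ℤ) → (Fin c → Fin k → ℤ) → Fin k → ℤ
combination {c} a b j = ∑[ i < c ] (a i * b i j)

record IsℤBasis {c k} (L : Pred (Fin k → ℤ) 0ℓ) (b : Fin c → Fin k → ℤ) : Set where
  field
    member      : ∀ i → L (b i)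
    independent : ∀ a → combination a b ≗ (λ _ → 0ℤ) → a ≗ (λ _ → 0ℤ)
    spanning    : ∀ x → L x → ∃[ a ] x ≗ combination a b

module RowQuotient {c t} (A : Fin c → Fin t → ℤ) where

  infix 4 _≈_

  record _≈_ (x y : Fin t → ℤ) : Set where
    constructor _by_
    field
      coefficients : Fin c → ℤ
      difference   : ∀ j → x j - y j ≡ combination coefficients A j

  private
    comb-0 : ∀ j → combination (λ _ → 0ℤ) A j ≡ 0ℤ
    comb-0 j = trans (sum-cong-≗ (λ i → ℤ.*-zeroˡ (A i j))) (sum-replicate-zero c)

    comb-+ : ∀ a b j → combination a A j + combination b A j ≡
                       combination (λ i → a i + b i) A j
    comb-+ a b j = sym (trans (sum-cong-≗ (λ i → ℤ.*-distribʳ-+ (A i j) (a i) (b i)))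
                              (∑-distrib-+ (λ i → a i * A i j) (λ i → b i * A i j)))

    comb-neg : ∀ a j → - combination a A j ≡ combination (λ i → - 1ℤ * a i) A j
    comb-neg a j = begin
      - combination a A j                     ≡⟨ ℤ.-1*i≡-i _ ⟨
      - 1ℤ * combination a A j                ≡⟨ *-distribˡ-sum (- 1ℤ) (λ i → a i * A i j) ⟩
      (∑[ i < c ] (- 1ℤ * (a i * A i j)))     ≡⟨ sum-cong-≗ (λ i → sym (ℤ.*-assoc (- 1ℤ) (a i) (A i j))) ⟩
      combination (λ i → - 1ℤ * a i) A j      ∎
      where open ≡-Reasoning

    open +-*-Solver

    lift : ∀ {x y} → x ≗ y → x ≈ y
    lift {x} {y} x≗y = (λ _ → 0ℤ) by λ j → begin
      x j - y j    ≡⟨ cong (_- y j) (x≗y j) ⟩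
      y j - y j    ≡⟨ ℤ.+-inverseʳ (y j) ⟩
      0ℤ           ≡⟨ comb-0 j ⟨
      combination (λ _ → 0ℤ) A j ∎
      where open ≡-Reasoning

    ≈-sym : ∀ {x y} → x ≈ y → y ≈ x
    ≈-sym {x} {y} (a by p) = (λ i → - 1ℤ * a i) by λ j → trans
      (solve 2 (λ u v → v :- u := :- (u :- v)) refl (x j) (y j))
      (trans (cong -_ (p j)) (comb-neg a j))

    ≈-trans : ∀ {x y z} → x ≈ y → y ≈ z → x ≈ z
    ≈-trans {x} {y} {z} (a by p) (b by q) = (λ i → a i + b i) by λ j → trans
      (solve 3 (λ u v w → u :- w := (u :- v) :+ (v :- w)) refl (x j) (y j) (z j))
      (trans (cong₂ _+_ (p j) (q j)) (comb-+ a b j))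

    +-resp : ∀ {x y u v} → x ≈ y → u ≈ v →
             (λ j → x j + u j) ≈ (λ j → y j + v j)
    +-resp {x} {y} {u} {v} (a by p) (b by q) = (λ i → a i + b i) by λ j → trans
      (solve 4 (λ x y u v → (x :+ u) :- (y :+ v) := (x :- y) :+ (u :- v)) refl
        (x j) (y j) (u j) (v j))
      (trans (cong₂ _+_ (p j) (q j)) (comb-+ a b j))

    neg-resp : ∀ {x y} → x ≈ y → (λ j → - x j) ≈ (λ j → - y j)
    neg-resp {x} {y} (a by p) = (λ i → - 1ℤ * a i) by λ j → trans
      (solve 2 (λ u v → (:- u) :- (:- v) := :- (u :- v)) refl (x j) (y j))
      (trans (cong -_ (p j)) (comb-neg a j))

    module P = AbelianGroup (ℤ^ t)

  group : AbelianGroup 0ℓ 0ℓ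
  group = record
    { Carrier = Fin t → ℤ
    ; _≈_     = _≈_
    ; _∙_     = P._∙_
    ; ε       = P.ε
    ; _⁻¹     = P._⁻¹
    ; isAbelianGroup = record
      { isGroup = record
        { isMonoid = record
          { isSemigroup = record
            { isMagma = record
              { isEquivalence = record
                { refl  = lift (λ _ → refl)
                ; sym   = ≈-sym
                ; trans = ≈-trans
                }
              ; ∙-cong = +-resp
              }
            ; assoc = λ x y z → lift (P.assoc x y z)
            }
          ; identity = (λ x → lift (P.identityˡ x)) , (λ x → lift (P.identityʳ x))
          }
        ; inverse = (λ x → lift (P.inverseˡ x)) , (λ x → lift (P.inverseʳ x))
        ; ⁻¹-cong = neg-resp
        }
      ; comm = λ x y → lift (P.comm x y)
      }
    }

module _ (Γ : AbelianGroup 0ℓ 0ℓ) where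

  open AbelianGroup Γ

  nonzero : ∀ {t} → (Fin t → Carrier) → Pred Carrier 0ℓ
  nonzero g x = ∃[ j ] (¬ g j ≈ ε) × x ≈ g j

  negative : Pred Carrier 0ℓ → Pred Carrier 0ℓ
  negative S x = S (x ⁻¹)

  CayleyAdj : Pred Carrier 0ℓ → Rel Carrier 0ℓ
  CayleyAdj S h h′ = ∃[ s ] (S ∪ negative S) s × h′ ≈ h ∙ s

  IsCayleyDistance : Pred Carrier 0ℓ → Carrier → Carrier → ℕ → Set
  IsCayleyDistance S = IsDistance _≈_ (CayleyAdj S)

-- Image of a subset, closed under the equality of the codomain.
image : (Γ Δ : AbelianGroup 0ℓ 0ℓ) →
        (AbelianGroup.Carrier Γ → AbelianGroup.Carrier Δ) →
        Pred (AbelianGroup.Carrier Γ) 0ℓ → Pred (AbelianGroup.Carrier Δ) 0ℓ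
image Γ Δ ψ S y = ∃[ s ] S s × AbelianGroup._≈_ Δ y (ψ s)

IsIsomorphism : (Γ Δ : AbelianGroup 0ℓ 0ℓ) →
                (AbelianGroup.Carrier Γ → AbelianGroup.Carrier Δ) → Set
IsIsomorphism Γ Δ =
  GroupMorphisms.IsGroupIsomorphism (AbelianGroup.rawGroup Γ) (AbelianGroup.rawGroup Δ)

-- The order in which `ends` lists the two endpoints is immaterial.
record Graph : Set where
  field
    n m  : ℕ
    ends : Fin m → Fin n × Fin n

  V : Set
  V = Fin n

  E : Set
  E = Fin m

  Joins : E → V → V → Set
  Joins e u v = ends e ≡ (u , v) ⊎ ends e ≡ (v , u)

  field
    noLoops    : ∀ e u → ¬ Joins e u u
    noParallel : ∀ e e′ u v → Joins e u v → Joins e′ u v → e ≡ e′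

  Adj : Rel V 0ℓ
  Adj u v = ∃[ e ] Joins e u v

  IsGraphDistance : V → V → ℕ → Set
  IsGraphDistance = IsDistance _≡_ Adj

  data Walk : V → V → Set where
    []  : ∀ {u} → Walk u u
    _∷_ : ∀ {u v w} → Adj u v → Walk v w → Walk u w

  length : ∀ {u v} → Walk u v → ℕ
  length []      = 0
  length (_ ∷ w) = suc (length w)

  -- Omits the final vertex, so that a closed walk lists its base once.
  visited : ∀ {u v} → Walk u v → List V
  visited []          = []
  visited {u} (_ ∷ w) = u ∷ visited w

  Connected : Set
  Connected = ∀ u v → Walk u v

  record Cycle : Set where
    field
      {base} : V
      walk   : Walk base base
      simple : Unique (visited walk)
      long   : 3 ≤ length walk

module _ (G : Graph) where

  open Graph G

  record Orientation : Set where
    field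
      tail head : E → V
      joins     : ∀ e → Joins e (tail e) (head e)

  record OrientedPartition : Set where
    field
      orientation : Orientation
      t           : ℕ
      class       : E → Fin t
      nonempty    : StrictlySurjective _≡_ class

    open Orientation orientation public

  allSingleton : Orientation → OrientedPartition
  allSingleton o = record
    { orientation = o
    ; t           = m
    ; class       = id
    ; nonempty    = λ e → e , refl
    }

signed : (Γ : AbelianGroup 0ℓ 0ℓ) → Sign → AbelianGroup.Carrier Γ → AbelianGroup.Carrier Γ
signed Γ Sign.+ x = x
signed Γ Sign.- x = AbelianGroup._⁻¹ Γ x

module _ {G : Graph} (o : Orientation G) where

  open Graph G
  open Orientation o

  -- Without loops, the starting vertex u determines whether e is traversed
  -- forwards or backwards.
  direction : E → V → Sign
  direction e u = if does (u ≟ tail e) then Sign.+ else Sign.-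

  walkSum : (Γ : AbelianGroup 0ℓ 0ℓ) → (E → AbelianGroup.Carrier Γ) →
            ∀ {u v} → Walk u v → AbelianGroup.Carrier Γ
  walkSum Γ g []                = AbelianGroup.ε Γ
  walkSum Γ g {u} ((e , _) ∷ w) =
    AbelianGroup._∙_ Γ (signed Γ (direction e u) (g e)) (walkSum Γ g w)

  incidence : ∀ {u v} → Walk u v → E → ℤ
  incidence w e′ = walkSum ℤ.+-0-abelianGroup (λ e → δ e e′) w

  ∂ : (E → ℤ) → V → ℤ
  ∂ x v = ∑[ e < m ] (x e * (δ (head e) v - δ (tail e) v))

  CycleLattice : Pred (E → ℤ) 0ℓ
  CycleLattice x = ∂ x ≗ (λ _ → 0ℤ)

  record CycleBasis : Set where
    field
      c       : ℕ
      cycle   : Fin c → Cycle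
      isBasis : IsℤBasis CycleLattice (λ i → incidence (Cycle.walk (cycle i)))

sum-δ : ∀ {k} (i : Fin k) (f : Fin k → ℤ) → (∑[ j < k ] (δ i j * f j)) ≡ f i
sum-δ {suc k} zero f = trans
  (cong₂ _+_ (ℤ.*-identityˡ (f zero))
    (trans (sum-cong-≗ (λ j → ℤ.*-zeroˡ (f (suc j)))) (sum-replicate-zero k)))
  (ℤ.+-identityʳ (f zero))
sum-δ {suc k} (suc i) f = trans
  (cong₂ _+_ (ℤ.*-zeroˡ (f zero)) (sum-δ i (f ∘ suc)))
  (ℤ.+-identityˡ (f (suc i)))

sum-neg : ∀ {k} (f : Fin k → ℤ) → (∑[ j < k ] (- f j)) ≡ - (∑[ j < k ] f j)
sum-neg f = trans (sum-cong-≗ (λ j → sym (ℤ.-1*i≡-i (f j))))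
            (trans (sym (*-distribˡ-sum (- 1ℤ) f)) (ℤ.-1*i≡-i (sum f)))

sum-- : ∀ {k} (f g : Fin k → ℤ) →
        (∑[ j < k ] (f j - g j)) ≡ (∑[ j < k ] f j) - (∑[ j < k ] g j)
sum-- f g = trans (∑-distrib-+ f (λ j → - g j)) (cong (sum f +_) (sum-neg g))

module WalkProperties {G : Graph} (o : Orientation G) where

  open Graph G
  open Orientation o

  ℤ⁺ : AbelianGroup 0ℓ 0ℓ
  ℤ⁺ = ℤ.+-0-abelianGroup

  inc : ∀ {u v} → Walk u v → E → ℤ
  inc = incidence o

  ws : (E → ℤ) → ∀ {u v} → Walk u v → ℤ
  ws f = walkSum o ℤ⁺ f

  signed-* : ∀ s x y → signed ℤ⁺ s x * y ≡ signed ℤ⁺ s (x * y)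
  signed-* Sign.+ x y = refl
  signed-* Sign.- x y = sym (ℤ.neg-distribˡ-* x y)

  sum-signed : ∀ {k} s (f : Fin k → ℤ) →
               (∑[ j < k ] signed ℤ⁺ s (f j)) ≡ signed ℤ⁺ s (sum f)
  sum-signed Sign.+ f = refl
  sum-signed Sign.- f = sum-neg f

  walkSum≡ : ∀ (f : E → ℤ) {u v} (w : Walk u v) → ws f w ≡ ∑[ e < m ] (inc w e * f e)
  walkSum≡ f [] = sym (trans (sum-cong-≗ (λ e → ℤ.*-zeroˡ (f e))) (sum-replicate-zero m))
  walkSum≡ f {u} ((e , _) ∷ w) = sym (begin
    (∑[ x < m ] ((signed ℤ⁺ s (δ e x) + inc w x) * f x))
      ≡⟨ sum-cong-≗ (λ x → ℤ.*-distribʳ-+ (f x) (signed ℤ⁺ s (δ e x)) (inc w x)) ⟩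
    (∑[ x < m ] (signed ℤ⁺ s (δ e x) * f x + inc w x * f x))
      ≡⟨ ∑-distrib-+ (λ x → signed ℤ⁺ s (δ e x) * f x) (λ x → inc w x * f x) ⟩
    (∑[ x < m ] (signed ℤ⁺ s (δ e x) * f x)) + (∑[ x < m ] (inc w x * f x))
      ≡⟨ cong₂ _+_
           (trans (sum-cong-≗ (λ x → signed-* s (δ e x) (f x)))
           (trans (sum-signed s (λ x → δ e x * f x))
                  (cong (signed ℤ⁺ s) (sum-δ e f))))
           (sym (walkSum≡ f w)) ⟩
    signed ℤ⁺ s (f e) + ws f w ∎)
    where
    open ≡-Reasoning
    s = direction o e u

  pair-≡ : ∀ {e a b c d} → ends e ≡ (a , b) → ends e ≡ (c , d) → a ≡ c × b ≡ d
  pair-≡ p q = cong proj₁ (trans (sym p) q) , cong proj₂ (trans (sym p) q)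

  endpoints : ∀ e u v → Joins e u v →
              (u ≡ tail e × v ≡ head e) ⊎ (u ≡ head e × v ≡ tail e)
  endpoints e u v (inj₁ p) with joins e
  ... | inj₁ q = inj₁ (pair-≡ p q)
  ... | inj₂ q = inj₂ (pair-≡ p q)
  endpoints e u v (inj₂ p) with joins e
  ... | inj₁ q = let (a , b) = pair-≡ p q in inj₂ (b , a)
  ... | inj₂ q = let (a , b) = pair-≡ p q in inj₁ (b , a)

  step-boundary : ∀ e u v → Joins e u v → ∀ x →
    signed ℤ⁺ (direction o e u) (δ (head e) x - δ (tail e) x) ≡ δ v x - δ u x
  step-boundary e u v j x with u ≟ tail e | endpoints e u v j
  ... | yes p | inj₁ (refl , refl) = refl
  ... | yes p | inj₂ (q , _) = contradiction
        (subst₂ (Joins e) (sym p) (sym q) (joins e)) (noLoops e u)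
  ... | no ¬p | inj₁ (p , _) = contradiction p ¬p
  ... | no ¬p | inj₂ (refl , refl) =
        let open +-*-Solver in
        solve 2 (λ a b → :- (a :- b) := b :- a) refl (δ (head e) x) (δ (tail e) x)

  telescope : ∀ {u v} (w : Walk u v) x →
              ws (λ e → δ (head e) x - δ (tail e) x) w ≡ δ v x - δ u x
  telescope {u} [] x = sym (ℤ.+-inverseʳ (δ u x))
  telescope {u} {v} (_∷_ {v = z} (e , j) w) x = trans
    (cong₂ _+_ (step-boundary e u z j x) (telescope w x))
    (let open +-*-Solver in
     solve 3 (λ a b c → (b :- a) :+ (c :- b) := c :- a) refl (δ u x) (δ z x) (δ v x))

  sum-difference : ∀ (f : E → ℤ) {u v u′ v′} (p : Walk u v) (q : Walk u′ v′) →
    (∑[ e < m ] ((inc p e - inc q e) * f e)) ≡ ws f p - ws f q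
  sum-difference f p q = begin
    (∑[ e < m ] ((inc p e - inc q e) * f e))
      ≡⟨ sum-cong-≗ (λ e → solve 3 (λ a b c → (a :- b) :* c := a :* c :- b :* c) refl
                              (inc p e) (inc q e) (f e)) ⟩
    (∑[ e < m ] (inc p e * f e - inc q e * f e))
      ≡⟨ sum-- (λ e → inc p e * f e) (λ e → inc q e * f e) ⟩
    (∑[ e < m ] (inc p e * f e)) - (∑[ e < m ] (inc q e * f e))
      ≡⟨ cong₂ _-_ (walkSum≡ f p) (walkSum≡ f q) ⟨
    ws f p - ws f q ∎
    where
    open ≡-Reasoning
    open +-*-Solver

  difference-closed : ∀ {u v} (p q : Walk u v) →
                      CycleLattice o (λ e → inc p e - inc q e)
  difference-closed {u} {v} p q x = trans
    (sum-difference (λ e → δ (head e) x - δ (tail e) x) p q)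
    (trans (cong₂ _-_ (telescope p x) (telescope q x))
           (ℤ.+-inverseʳ (δ v x - δ u x)))

module _ {G : Graph} (P : OrientedPartition G)
         (B : CycleBasis (OrientedPartition.orientation P)) where

  open Graph G
  open OrientedPartition P
  open CycleBasis B

  crossings : ∀ {u v} → Walk u v → Fin t → ℤ
  crossings w j = walkSum orientation ℤ.+-0-abelianGroup (λ e → δ (class e) j) w

  cycleClassMatrix : Fin c → Fin t → ℤ
  cycleClassMatrix i = crossings (Cycle.walk (cycle i))

  Γ-univ : AbelianGroup 0ℓ 0ℓ
  Γ-univ = RowQuotient.group cycleClassMatrix

  open AbelianGroup Γ-univ using (Carrier; _≈_)

  generator : Fin t → Carrier
  generator = δ

  connectionSet : Pred Carrier 0ℓ
  connectionSet = nonzero Γ-univ generator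

  label : ∀ {u v} → Walk u v → Carrier
  label = walkSum orientation Γ-univ (generator ∘ class)

  -- The choice of walk is irrelevant, by `path-independent` below.
  quotientLabeling : Connected → V → V → Carrier
  quotientLabeling conn r v = label (conn r v)

  open WalkProperties orientation

  private
    label≡crossings : ∀ {u v} (w : Walk u v) → label w ≗ crossings w
    label≡crossings []                j = refl
    label≡crossings {u} ((e , _) ∷ w) j with direction orientation e u
    ... | Sign.+ = cong (δ (class e) j +_) (label≡crossings w j)
    ... | Sign.- = cong (- δ (class e) j +_) (label≡crossings w j)

    cyc : ∀ i → Walk (Cycle.base (cycle i)) (Cycle.base (cycle i))
    cyc i = Cycle.walk (cycle i)

  open RowQuotient cycleClassMatrix using (_by_)

  path-independent : ∀ {u v} (p q : Walk u v) → label p ≈ label q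
  path-independent p q = a by λ j → begin
    label p j - label q j
      ≡⟨ cong₂ _-_ (label≡crossings p j) (label≡crossings q j) ⟩
    crossings p j - crossings q j
      ≡⟨ sum-difference (f j) p q ⟨
    (∑[ e < m ] ((inc p e - inc q e) * f j e))
      ≡⟨ sum-cong-≗ (λ e → cong (_* f j e) (x≡ e)) ⟩
    (∑[ e < m ] ((∑[ i < c ] (a i * inc (cyc i) e)) * f j e))
      ≡⟨ sum-cong-≗ (λ e → *-distribʳ-sum (f j e) (λ i → a i * inc (cyc i) e)) ⟩
    (∑[ e < m ] ∑[ i < c ] (a i * inc (cyc i) e * f j e))
      ≡⟨ ∑-comm (λ e i → a i * inc (cyc i) e * f j e) ⟩
    (∑[ i < c ] ∑[ e < m ] (a i * inc (cyc i) e * f j e))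
      ≡⟨ sum-cong-≗ (λ i → trans
           (sum-cong-≗ (λ e → ℤ.*-assoc (a i) (inc (cyc i) e) (f j e)))
           (trans (sym (*-distribˡ-sum (a i) (λ e → inc (cyc i) e * f j e)))
                  (cong (a i *_) (sym (walkSum≡ (f j) (cyc i)))))) ⟩
    combination a cycleClassMatrix j ∎
    where
    open ≡-Reasoning
    f : Fin t → E → ℤ
    f j e = δ (class e) j
    spanned = IsℤBasis.spanning isBasis (λ e → inc p e - inc q e) (difference-closed p q)
    a = proj₁ spanned
    x≡ = proj₂ spanned

-- Distances are unique when they exist, so this says that both are
-- defined and that they agree.
IsIsometric : (G : Graph) (Γ : AbelianGroup 0ℓ 0ℓ) → Pred (AbelianGroup.Carrier Γ) 0ℓ →
              (Graph.V G → AbelianGroup.Carrier Γ) → Set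
IsIsometric G Γ S φ = ∀ u v →
  ∃[ d ] Graph.IsGraphDistance G u v d × IsCayleyDistance Γ S (φ u) (φ v) d

{-# OPTIONS --safe #-}

-- The boundary map ∂ has the cycle lattice as its kernel and, G being
-- connected, the vectors of coordinate sum zero as its image; dropping one
-- coordinate identifies the latter with ℤ^(n−1).  An edge of G moves φ along
-- its generator, so φ does not increase distances.  Conversely, for a fixed
-- target v the potential x ↦ Σ_w ∂x(w) d(w , v) is a homomorphism on Γ that
-- changes by at most one along every edge of the Cayley graph and that drops
-- by d(u , v) from φ(u) to φ(v), so φ does not decrease distances either.

module Submission where

open import Defs
open import Level using (0ℓ)
open import Algebra.Bundles using (AbelianGroup)
open import Algebra.Morphism.Structures using (module GroupMorphisms)
import Algebra.Properties.Group as GroupProperties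
open import Data.Bool using (if_then_else_)
open import Data.Fin using (Fin; zero; suc; _≟_)
open import Data.Fin.Properties using (any?)
open import Data.Integer as ℤ using (ℤ; +_; 0ℤ; 1ℤ; -1ℤ; _+_; _-_; _*_; -_)
import Data.Integer.Properties as ℤ
open import Data.Integer.Solver using (module +-*-Solver)
open import Data.Nat as ℕ using (ℕ; zero; suc; _∸_; z≤n; s≤s)
import Data.Nat.Properties as ℕ
open import Data.Product using (Σ-syntax; ∃-syntax; _×_; _,_; proj₁; proj₂)
open import Data.Product.Properties using (≡-dec)
open import Data.Sign using (Sign)
open import Data.Sum using (inj₁; inj₂; swap)
open import Function using (_∘_)
open import Relation.Binary using (Symmetric; _Respects_)
open import Relation.Binary.PropositionalEquality
open import Relation.Nullary using (Dec; yes; no; contradiction)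
open import Relation.Nullary.Decidable using (map′; _×-dec_; _⊎-dec_; dec-true; dec-false)
open import Relation.Unary using (Pred; Decidable; _∪_)

-- Least witnesses, Kronecker deltas and finite sums.

least : {P : Pred ℕ 0ℓ} → Decidable P → ∀ {n} → P n →
        ∃[ d ] P d × (∀ k → P k → d ℕ.≤ k)
least P? {n} p with P? 0
least P? {n}     p | yes p₀ = 0 , p₀ , λ _ _ → z≤n
least P? {zero}  p | no ¬p₀ = contradiction p ¬p₀
least P? {suc n} p | no ¬p₀ with least (P? ∘ suc) p
... | d , q , d≤ = suc d , q , λ where
  zero    p₀ → contradiction p₀ ¬p₀
  (suc k) p′ → s≤s (d≤ k p′)

δ-refl : ∀ {k} (i : Fin k) → δ i i ≡ 1ℤ
δ-refl i = cong (if_then 1ℤ else 0ℤ) (dec-true (i ≟ i) refl)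

δ-≢ : ∀ {k} {i j : Fin k} → i ≢ j → δ i j ≡ 0ℤ
δ-≢ {i = i} {j} i≢j = cong (if_then 1ℤ else 0ℤ) (dec-false (i ≟ j) i≢j)

δ-sym : ∀ {k} (i j : Fin k) → δ i j ≡ δ j i
δ-sym i j with i ≟ j
... | yes refl = sym (δ-refl i)
... | no i≢j   = sym (δ-≢ (i≢j ∘ sym))

sum-δ-δ : ∀ {k} (i j : Fin k) (f : Fin k → ℤ) →
          (∑[ l < k ] ((δ i l - δ j l) * f l)) ≡ f i - f j
sum-δ-δ i j f = trans
  (sum-cong-≗ λ l → solve 3 (λ a b c → (a :- b) :* c := a :* c :- b :* c) refl
                      (δ i l) (δ j l) (f l))
  (trans (sum-- (λ l → δ i l * f l) (λ l → δ j l * f l))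
         (cong₂ _-_ (sum-δ i f) (sum-δ j f)))
  where open +-*-Solver

-- Interchange of the two summations. It later gives both the linearity of `∂` and the vanishing of
-- its coordinate sum.
sum-combination-* : ∀ {c k} (a : Fin c → ℤ) (b : Fin c → Fin k → ℤ) (f : Fin k → ℤ) →
  (∑[ j < k ] (combination a b j * f j)) ≡ (∑[ i < c ] (a i * ∑[ j < k ] (b i j * f j)))
sum-combination-* {c} {k} a b f = begin
  (∑[ j < k ] (combination a b j * f j))
    ≡⟨ sum-cong-≗ (λ j → *-distribʳ-sum (f j) (λ i → a i * b i j)) ⟩
  (∑[ j < k ] ∑[ i < c ] (a i * b i j * f j))
    ≡⟨ ∑-comm (λ j i → a i * b i j * f j) ⟩
  (∑[ i < c ] ∑[ j < k ] (a i * b i j * f j))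
    ≡⟨ sum-cong-≗ (λ i → trans
         (sum-cong-≗ (λ j → ℤ.*-assoc (a i) (b i j) (f j)))
         (sym (*-distribˡ-sum (a i) (λ j → b i j * f j)))) ⟩
  (∑[ i < c ] (a i * ∑[ j < k ] (b i j * f j))) ∎
  where open ≡-Reasoning

sum-*-0 : ∀ {k} (a : Fin k → ℤ) {b : Fin k → ℤ} → b ≗ (λ _ → 0ℤ) →
          (∑[ i < k ] (a i * b i)) ≡ 0ℤ
sum-*-0 {k} a b≗0 = trans
  (sum-cong-≗ λ i → trans (cong (a i *_) (b≗0 i)) (ℤ.*-zeroʳ (a i)))
  (sum-replicate-zero k)

-- Integer vectors of coordinate sum zero.

nonfirst : ∀ {k} → Fin (k ∸ 1) → Fin k
nonfirst {suc k} = suc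

-- The first coordinate is minus the sum of the others, so dropping it loses no information.
sum≡0-ext : ∀ {k} (f g : Fin k → ℤ) → sum f ≡ 0ℤ → sum g ≡ 0ℤ →
            f ∘ nonfirst ≗ g ∘ nonfirst → f ≗ g
sum≡0-ext {suc k} f g Σf Σg f≗g (suc i) = f≗g i
sum≡0-ext {suc k} f g Σf Σg f≗g zero    =
  ∙-cancelʳ (sum (f ∘ suc)) (f zero) (g zero) (begin
    f zero + sum (f ∘ suc) ≡⟨ Σf ⟩
    0ℤ                     ≡⟨ Σg ⟨
    g zero + sum (g ∘ suc) ≡⟨ cong (_+_ (g zero)) (sum-cong-≗ f≗g) ⟨
    g zero + sum (f ∘ suc) ∎)
  where
  open ≡-Reasoning
  open GroupProperties (AbelianGroup.group ℤ.+-0-abelianGroup) using (∙-cancelʳ)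

sum≡0-extend : ∀ {k} (y : Fin (k ∸ 1) → ℤ) →
               ∃[ z ] sum z ≡ 0ℤ × z ∘ nonfirst {k} ≗ y
sum≡0-extend {zero}  y = (λ ()) , refl , λ ()
sum≡0-extend {suc k} y =
  (λ { zero → - sum y ; (suc i) → y i }) , ℤ.+-inverseˡ (sum y) , λ _ → refl

-- Cayley graphs under injective homomorphisms.

module _ (Γ Δ : AbelianGroup 0ℓ 0ℓ) where

  private
    module Γ = AbelianGroup Γ
    module Δ = AbelianGroup Δ

  open GroupProperties Γ.group using () renaming (⁻¹-involutive to Γ-⁻¹-involutive)
  open GroupProperties Δ.group using () renaming (⁻¹-involutive to Δ-⁻¹-involutive)
  open GroupMorphisms Γ.rawGroup Δ.rawGroup using (IsGroupMonomorphism)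

  module _ {ψ : Γ.Carrier → Δ.Carrier} (mono : IsGroupMonomorphism ψ)
           {S : Pred Γ.Carrier 0ℓ} (S-resp : S Respects Γ._≈_) where

    open IsGroupMonomorphism mono

    mono-Reach : ∀ {x y k} → Reach Γ._≈_ (CayleyAdj Γ S) x y k →
                 Reach Δ._≈_ (CayleyAdj Δ (image Γ Δ ψ S)) (ψ x) (ψ y) k
    mono-Reach (here x≈y) = here (⟦⟧-cong x≈y)
    mono-Reach (step {x} (s , s∈ , v≈) p) = step
      (ψ s , ψs∈ s∈ , Δ.trans (⟦⟧-cong v≈) (∙-homo x s)) (mono-Reach p)
      where
      ψs∈ : (S ∪ negative Γ S) s → (image Γ Δ ψ S ∪ negative Δ (image Γ Δ ψ S)) (ψ s)
      ψs∈ (inj₁ s∈S)  = inj₁ (s , s∈S , Δ.refl)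
      ψs∈ (inj₂ -s∈S) = inj₂ (s Γ.⁻¹ , -s∈S , Δ.sym (⁻¹-homo s))

    -- Every step in the image graph is, up to equality, `ψ` of a generator or of its inverse, so a
    -- walk starting at an image stays among images and lifts step by step. Injectivity closes the
    -- lift at its endpoint.
    mono-Reach⁻¹ : ∀ {x y k} a b → x Δ.≈ ψ a → y Δ.≈ ψ b →
                   Reach Δ._≈_ (CayleyAdj Δ (image Γ Δ ψ S)) x y k →
                   Reach Γ._≈_ (CayleyAdj Γ S) a b k
    mono-Reach⁻¹ a b x≈ y≈ (here x≈y) =
      here (injective (Δ.trans (Δ.sym x≈) (Δ.trans x≈y y≈)))
    mono-Reach⁻¹ a b x≈ y≈ (step (s , inj₁ (t , t∈S , s≈) , v≈) p) = step
      (t , inj₁ t∈S , Γ.refl)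
      (mono-Reach⁻¹ (a Γ.∙ t) b
        (Δ.trans v≈ (Δ.trans (Δ.∙-cong x≈ s≈) (Δ.sym (∙-homo a t)))) y≈ p)
    mono-Reach⁻¹ a b x≈ y≈ (step (s , inj₂ (t , t∈S , -s≈) , v≈) p) = step
      -- Here the inverse of `s` is the image of `t`, so the lifted step is `t Γ.⁻¹`. Membership in
      -- `negative Γ S` concerns its inverse, which equals `t` only up to `Γ._≈_`; hence `S-resp`.
      (t Γ.⁻¹ , inj₂ (S-resp (Γ.sym (Γ-⁻¹-involutive t)) t∈S) , Γ.refl)
      (mono-Reach⁻¹ (a Γ.∙ t Γ.⁻¹) b
        (Δ.trans v≈ (Δ.trans (Δ.∙-cong x≈ s≈) (Δ.sym (∙-homo a (t Γ.⁻¹))))) y≈ p)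
      where
      s≈ : s Δ.≈ ψ (t Γ.⁻¹)
      s≈ = Δ.trans (Δ.sym (Δ-⁻¹-involutive s))
             (Δ.trans (Δ.⁻¹-cong -s≈) (Δ.sym (⁻¹-homo t)))

    mono-IsIsometric : ∀ (G : Graph) {φ : Graph.V G → Γ.Carrier} →
      IsIsometric G Γ S φ → IsIsometric G Δ (image Γ Δ ψ S) (ψ ∘ φ)
    mono-IsIsometric G {φ} isometric u v with isometric u v
    ... | d , d-graph , reach , d≤ = d , d-graph , mono-Reach reach , λ k p →
      d≤ k (mono-Reach⁻¹ (φ u) (φ v) Δ.refl Δ.refl p)

-- Shortest-path distance in a finite connected graph.

module Distance (G : Graph) (conn : Graph.Connected G) where

  open Graph G

  Adj? : ∀ u v → Dec (Adj u v)
  Adj? u v = any? λ e →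
    ≡-dec _≟_ _≟_ (ends e) (u , v) ⊎-dec ≡-dec _≟_ _≟_ (ends e) (v , u)

  Adj-sym : Symmetric Adj
  Adj-sym (e , j) = e , swap j

  -- With the number of steps fixed, only finitely many second vertices need be tried; this is what
  -- makes `least` applicable.
  Reach? : ∀ u v → Decidable (Reach _≡_ Adj u v)
  Reach? u v zero    = map′ here (λ { (here u≡v) → u≡v }) (u ≟ v)
  Reach? u v (suc k) = map′ (λ (_ , a , p) → step a p) (λ { (step a p) → _ , a , p })
    (any? λ w → Adj? u w ×-dec Reach? w v k)

  walk⇒Reach : ∀ {u v} (w : Walk u v) → Reach _≡_ Adj u v (length w)
  walk⇒Reach []      = here refl
  walk⇒Reach (a ∷ w) = step a (walk⇒Reach w)

  distance : ∀ u v → ∃[ d ] IsGraphDistance u v d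
  distance u v = least (Reach? u v) (walk⇒Reach (conn u v))

  dist : V → V → ℕ
  dist u v = proj₁ (distance u v)

  dist-self : ∀ v → dist v v ≡ 0
  dist-self v with distance v v
  ... | zero  , _      = refl
  ... | suc d , _ , d≤ = contradiction (d≤ 0 (here refl)) λ ()

  -- Prepend the edge to a shortest walk from `w`. The distance to a fixed target thus qualifies as
  -- the function `f` of the potential below.
  dist-Lipschitz : ∀ {u w} v → Adj u w → dist u v ℕ.≤ suc (dist w v)
  dist-Lipschitz {u} {w} v a =
    proj₂ (proj₂ (distance u v)) _ (step a (proj₁ (proj₂ (distance w v))))

-- The boundary map, its image and its kernel.

module Boundary {G : Graph} (o : Orientation G) where

  open Graph G
  open Orientation o
  open WalkProperties o using (walkSum≡; telescope)

  ∂-cong : ∀ {x y} → x ≗ y → ∂ o x ≗ ∂ o y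
  ∂-cong x≗y v = sum-cong-≗ λ e → cong (_* (δ (head e) v - δ (tail e) v)) (x≗y e)

  ∂-+ : ∀ x y v → ∂ o (λ e → x e + y e) v ≡ ∂ o x v + ∂ o y v
  ∂-+ x y v = trans
    (sum-cong-≗ λ e → ℤ.*-distribʳ-+ (δ (head e) v - δ (tail e) v) (x e) (y e))
    (∑-distrib-+ (λ e → x e * (δ (head e) v - δ (tail e) v))
                 (λ e → y e * (δ (head e) v - δ (tail e) v)))

  ∂-neg : ∀ x v → ∂ o (λ e → - x e) v ≡ - ∂ o x v
  ∂-neg x v = trans
    (sum-cong-≗ λ e → sym (ℤ.neg-distribˡ-* (x e) (δ (head e) v - δ (tail e) v)))
    (sum-neg (λ e → x e * (δ (head e) v - δ (tail e) v)))

  ∂-- : ∀ x y v → ∂ o (λ e → x e - y e) v ≡ ∂ o x v - ∂ o y v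
  ∂-- x y v = trans (∂-+ x (λ e → - y e) v) (cong (_+_ (∂ o x v)) (∂-neg y v))

  ∂-0 : ∀ v → ∂ o (λ _ → 0ℤ) v ≡ 0ℤ
  ∂-0 v = sum-replicate-zero m

  ∂-δ : ∀ e v → ∂ o (δ e) v ≡ δ (head e) v - δ (tail e) v
  ∂-δ e v = sum-δ e (λ e → δ (head e) v - δ (tail e) v)

  ∂-incidence : ∀ {u v} (w : Walk u v) x → ∂ o (incidence o w) x ≡ δ v x - δ u x
  ∂-incidence w x = trans
    (sym (walkSum≡ (λ e → δ (head e) x - δ (tail e) x) w)) (telescope w x)

  ∂-combination : ∀ {c} (a : Fin c → ℤ) (b : Fin c → E → ℤ) v →
                  ∂ o (combination a b) v ≡ ∑[ i < c ] (a i * ∂ o (b i) v)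
  ∂-combination a b v = sum-combination-* a b (λ e → δ (head e) v - δ (tail e) v)

  -- Each edge contributes one unit at its head and minus one at its tail.
  sum-∂ : ∀ x → sum (∂ o x) ≡ 0ℤ
  sum-∂ x = begin
    sum (∂ o x)                      ≡⟨ sum-cong-≗ (λ v → ℤ.*-identityʳ (∂ o x v)) ⟨
    (∑[ v < n ] (∂ o x v * 1ℤ))      ≡⟨ sum-combination-* x (λ e v → δ (head e) v - δ (tail e) v) (λ _ → 1ℤ) ⟩
    (∑[ e < m ] (x e * ∑[ v < n ] ((δ (head e) v - δ (tail e) v) * 1ℤ)))
                                     ≡⟨ sum-*-0 x (λ e → sum-δ-δ (head e) (tail e) (λ _ → 1ℤ)) ⟩
    0ℤ                               ∎
    where open ≡-Reasoning

  -- Send `z v` units along the chosen walk from `r` to `v`. Each walk has boundary `δ v - δ r`, and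
  -- the contributions at `r` total minus `sum z`, which is zero.
  ∂-surjective : Connected → V → ∀ z → sum z ≡ 0ℤ → ∃[ x ] ∂ o x ≗ z
  ∂-surjective conn r z Σz≡0 = combination z (λ v → incidence o (conn r v)) , λ x → begin
    ∂ o (combination z (λ v → incidence o (conn r v))) x
      ≡⟨ ∂-combination z (λ v → incidence o (conn r v)) x ⟩
    (∑[ v < n ] (z v * ∂ o (incidence o (conn r v)) x))
      ≡⟨ sum-cong-≗ (λ v → trans (cong (z v *_) (trans (∂-incidence (conn r v) x)
           (cong (_- δ r x) (δ-sym v x))))
           (solve 3 (λ z a b → z :* (a :- b) := a :* z :- z :* b) refl (z v) (δ x v) (δ r x))) ⟩
    (∑[ v < n ] (δ x v * z v - z v * δ r x))
      ≡⟨ sum-- (λ v → δ x v * z v) (λ v → z v * δ r x) ⟩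
    (∑[ v < n ] (δ x v * z v)) - (∑[ v < n ] (z v * δ r x))
      ≡⟨ cong₂ _-_ (sum-δ x z) (trans (sym (*-distribʳ-sum (δ r x) z))
           (cong (_* δ r x) Σz≡0)) ⟩
    z x - 0ℤ * δ r x
      ≡⟨ solve 2 (λ z b → z :- con 0ℤ :* b := z) refl (z x) (δ r x) ⟩
    z x ∎
    where
    open ≡-Reasoning
    open +-*-Solver

  module _ (B : CycleBasis o) where

    open CycleBasis B
    open AbelianGroup (Γ-univ (allSingleton G o) B) using (_≈_)
    open RowQuotient (cycleClassMatrix (allSingleton G o) B) using (_by_)

    -- For singleton classes the rows of the matrix are the incidence vectors of the basis cycles,
    -- which `∂` kills; so `∂` descends to the quotient.
    ≈⇒∂≗ : ∀ {x y} → x ≈ y → ∂ o x ≗ ∂ o y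
    ≈⇒∂≗ {x} {y} (a by x-y) v = ℤ.i-j≡0⇒i≡j (∂ o x v) (∂ o y v) (begin
      ∂ o x v - ∂ o y v          ≡⟨ ∂-- x y v ⟨
      ∂ o (λ e → x e - y e) v    ≡⟨ ∂-cong x-y v ⟩
      ∂ o (combination a _) v    ≡⟨ ∂-combination a _ v ⟩
      _                          ≡⟨ sum-*-0 a (λ i → IsℤBasis.member isBasis i v) ⟩
      0ℤ                         ∎)
      where open ≡-Reasoning

    -- Vectors with equal boundary differ by an element of the cycle lattice, which the basis cycles
    -- span. From here on, equations in the quotient are checked on boundaries.
    ∂≗⇒≈ : ∀ {x y} → ∂ o x ≗ ∂ o y → x ≈ y
    ∂≗⇒≈ {x} {y} ∂x≗∂y = a by x-y
      where
      spanned = IsℤBasis.spanning isBasis (λ e → x e - y e) λ v → trans (∂-- x y v)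
        (trans (cong (_- ∂ o y v) (∂x≗∂y v)) (ℤ.+-inverseʳ (∂ o y v)))
      a   = proj₁ spanned
      x-y = proj₂ spanned

-- The isomorphism of the universal group with `ℤ^ (n ∸ 1)`.

module _ {G : Graph} (conn : Graph.Connected G) (o : Orientation G)
         (B : CycleBasis o) (r : Graph.V G) where

  open Graph G
  open Orientation o
  open Distance G conn
  open Boundary o
  open WalkProperties o using (step-boundary)

  private
    P = allSingleton G o
    Γ = Γ-univ P B
    Δ = ℤ^ (n ∸ 1)
    S = connectionSet P B
    φ = quotientLabeling P B conn r

  open AbelianGroup Γ using (Carrier; _≈_; _∙_; ε)

  ψ : Carrier → AbelianGroup.Carrier Δ
  ψ x = ∂ o x ∘ nonfirst

  ψ-isIsomorphism : IsIsomorphism Γ Δ ψ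
  ψ-isIsomorphism = record
    { isGroupMonomorphism = record
      { isGroupHomomorphism = record
        { isMonoidHomomorphism = record
          { isMagmaHomomorphism = record
            { isRelHomomorphism = record { cong = λ x≈y → ≈⇒∂≗ B x≈y ∘ nonfirst }
            ; homo = λ x y → ∂-+ x y ∘ nonfirst
            }
          ; ε-homo = ∂-0 ∘ nonfirst
          }
        ; ⁻¹-homo = λ x → ∂-neg x ∘ nonfirst
        }
      ; injective = λ {x} {y} ψx≗ψy → ∂≗⇒≈ B
          (sum≡0-ext (∂ o x) (∂ o y) (sum-∂ x) (sum-∂ y) ψx≗ψy)
      }
    ; surjective = λ y →
        let z , Σz≡0 , z≗y = sum≡0-extend y
            x , ∂x≗z       = ∂-surjective conn r z Σz≡0
        -- Surjectivity demands the equation for every representative `x′` of the class of `x`.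
        in x , λ x′≈x i → trans (≈⇒∂≗ B x′≈x (nonfirst i)) (trans (∂x≗z (nonfirst i)) (z≗y i))
    }

  -- Boundaries of labels and of Cayley generators.

  ∂-signed : ∀ s x v → ∂ o (signed Γ s x) v ≡ signed ℤ.+-0-abelianGroup s (∂ o x v)
  ∂-signed Sign.+ x v = refl
  ∂-signed Sign.- x v = ∂-neg x v

  ∂-edge : ∀ e u v → Joins e u v → ∀ x →
           ∂ o (signed Γ (direction o e u) (δ e)) x ≡ δ v x - δ u x
  ∂-edge e u v j x = trans (∂-signed (direction o e u) (δ e) x)
    (trans (cong (signed ℤ.+-0-abelianGroup (direction o e u)) (∂-δ e x))
           (step-boundary e u v j x))

  -- Edge boundaries telescope along the walk. In particular `φ v` has boundary `δ v - δ r`, the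
  -- only fact about `φ` used below.
  ∂-label : ∀ {u v} (w : Walk u v) x → ∂ o (label P B w) x ≡ δ v x - δ u x
  ∂-label {u} [] x = trans (∂-0 x) (sym (ℤ.+-inverseʳ (δ u x)))
  ∂-label {u} {v} (_∷_ {v = z} (e , j) w) x = trans
    (∂-+ (signed Γ (direction o e u) (δ e)) (label P B w) x)
    (trans (cong₂ _+_ (∂-edge e u z j x) (∂-label w x))
      (solve 3 (λ a b c → (b :- a) :+ (c :- b) := c :- a) refl (δ u x) (δ z x) (δ v x)))
    where open +-*-Solver

  -- Unless the endpoints coincide, the boundary of `δ e` takes the value 1 at `head e`. As loops
  -- are excluded, every generator is nonzero and belongs to `S`.
  generator≈ε⇒loop : ∀ e → generator P B e ≈ ε → head e ≡ tail e
  generator≈ε⇒loop e ge≈ε with head e ≟ tail e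
  ... | yes h≡t = h≡t
  ... | no h≢t  = contradiction 1≡0 λ ()
    where
    open ≡-Reasoning
    1≡0 : 1ℤ ≡ 0ℤ
    1≡0 = begin
      1ℤ                                  ≡⟨ cong₂ _-_ (δ-refl (head e)) (δ-≢ (h≢t ∘ sym)) ⟨
      δ (head e) (head e) - δ (tail e) (head e) ≡⟨ ∂-δ e (head e) ⟨
      ∂ o (δ e) (head e)                  ≡⟨ ≈⇒∂≗ B ge≈ε (head e) ⟩
      ∂ o (λ _ → 0ℤ) (head e)             ≡⟨ ∂-0 (head e) ⟩
      0ℤ                                  ∎

  generator∈S : ∀ e → S (generator P B e)
  generator∈S e = e , (λ ge≈ε → noLoops e (head e)
    (subst (λ u → Joins e u (head e)) (sym (generator≈ε⇒loop e ge≈ε)) (joins e))) , AbelianGroup.refl Γ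

  φ-Adj : ∀ {u v} → Adj u v → CayleyAdj Γ S (φ u) (φ v)
  φ-Adj {u} {v} (e , j) = s , s∈ (direction o e u) , ∂≗⇒≈ B λ x → begin
    ∂ o (φ v) x                        ≡⟨ ∂-label (conn r v) x ⟩
    δ v x - δ r x                      ≡⟨ solve 3 (λ r u v → v :- r := (u :- r) :+ (v :- u)) refl (δ r x) (δ u x) (δ v x) ⟩
    (δ u x - δ r x) + (δ v x - δ u x)  ≡⟨ cong₂ _+_ (∂-label (conn r u) x) (∂-edge e u v j x) ⟨
    ∂ o (φ u) x + ∂ o s x              ≡⟨ ∂-+ (φ u) s x ⟨
    ∂ o (φ u ∙ s) x                    ∎
    where
    open ≡-Reasoning
    open +-*-Solver
    s = signed Γ (direction o e u) (δ e)
    s∈ : ∀ σ → (S ∪ negative Γ S) (signed Γ σ (δ e))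
    s∈ Sign.+ = inj₁ (generator∈S e)
    -- A backward traversal moves by the inverse of the generator.
    s∈ Sign.- = inj₂ (proj₁ (generator∈S e) , proj₁ (proj₂ (generator∈S e)) ,
      GroupProperties.⁻¹-involutive (AbelianGroup.group Γ) (δ e))

  φ-Reach : ∀ {u v k} → Reach _≡_ Adj u v k → Reach _≈_ (CayleyAdj Γ S) (φ u) (φ v) k
  φ-Reach (here refl) = here (AbelianGroup.refl Γ)
  φ-Reach (step a p)  = step (φ-Adj a) (φ-Reach p)

  -- An element of `S` is a generator only up to `≈`, so its boundary, not the vector itself, is
  -- what is determined. Reversing the edge accounts for the negatives.
  ∂-S : ∀ {s} → (S ∪ negative Γ S) s →
        ∃[ u ] ∃[ v ] Adj u v × (∀ w → ∂ o s w ≡ δ v w - δ u w)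
  ∂-S (inj₁ (e , _ , s≈)) = tail e , head e , (e , joins e) , λ w →
    trans (≈⇒∂≗ B s≈ w) (∂-δ e w)
  ∂-S {s} (inj₂ (e , _ , -s≈)) = head e , tail e , Adj-sym (e , joins e) , λ w → begin
    ∂ o s w                         ≡⟨ ℤ.neg-involutive (∂ o s w) ⟨
    - - ∂ o s w                     ≡⟨ cong -_ (∂-neg s w) ⟨
    - ∂ o (λ j → - s j) w           ≡⟨ cong -_ (trans (≈⇒∂≗ B -s≈ w) (∂-δ e w)) ⟩
    - (δ (head e) w - δ (tail e) w) ≡⟨ solve 2 (λ a b → :- (a :- b) := b :- a) refl (δ (head e) w) (δ (tail e) w) ⟩
    δ (tail e) w - δ (head e) w     ∎
    where
    open ≡-Reasoning
    open +-*-Solver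

  -- Potentials and the lower bound on Cayley distance.

  module _ (f : V → ℕ) (f-Lipschitz : ∀ {u v} → Adj u v → f u ℕ.≤ suc (f v)) where

    -- The pairing of the boundary with `f`; summation by parts makes it the sum of `x e` times the
    -- increment of `f` along `e`. Depending on `x` only through `∂ o x`, it is well defined on the
    -- quotient.
    potential : Carrier → ℤ
    potential x = ∑[ w < n ] (∂ o x w * + f w)

    potential-cong : ∀ {x y} → x ≈ y → potential x ≡ potential y
    potential-cong x≈y = sum-cong-≗ λ w → cong (_* + f w) (≈⇒∂≗ B x≈y w)

    potential-∙ : ∀ x y → potential (x ∙ y) ≡ potential x + potential y
    potential-∙ x y = trans
      (sum-cong-≗ λ w → trans (cong (_* + f w) (∂-+ x y w))
                              (ℤ.*-distribʳ-+ (+ f w) (∂ o x w) (∂ o y w)))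
      (∑-distrib-+ (λ w → ∂ o x w * + f w) (λ w → ∂ o y w * + f w))

    potential-∂ : ∀ x {u v} → (∀ w → ∂ o x w ≡ δ v w - δ u w) → potential x ≡ + f v - + f u
    potential-∂ x {u} {v} ∂x = trans (sum-cong-≗ λ w → cong (_* + f w) (∂x w))
                                       (sum-δ-δ v u (λ w → + f w))

    -- Such an `s` has the boundary of one directed edge from `u` to `v`, so its potential is `f v`
    -- minus `f u`. This bound limits how fast the potential can fall along a Cayley walk.
    -1≤potential : ∀ {s} → (S ∪ negative Γ S) s → -1ℤ ℤ.≤ potential s
    -1≤potential {s} s∈ with ∂-S s∈
    ... | u , v , a , ∂s = begin
      -1ℤ                    ≡⟨ solve 1 (λ b → con -1ℤ := b :- (con 1ℤ :+ b)) refl (+ f v) ⟩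
      + f v - (1ℤ + + f v)   ≤⟨ ℤ.+-monoʳ-≤ (+ f v) (ℤ.neg-mono-≤ (ℤ.+≤+ (f-Lipschitz a))) ⟩
      + f v - + f u          ≡⟨ potential-∂ s ∂s ⟨
      potential s            ∎
      where
      open ℤ.≤-Reasoning
      open +-*-Solver

    potential-CayleyAdj : ∀ {x y} → CayleyAdj Γ S x y → potential x ℤ.≤ 1ℤ + potential y
    potential-CayleyAdj {x} {y} (s , s∈ , y≈x∙s) = begin
      potential x                      ≡⟨ solve 1 (λ a → a := con 1ℤ :+ (a :+ con -1ℤ)) refl (potential x) ⟩
      1ℤ + (potential x + -1ℤ)         ≤⟨ ℤ.+-monoʳ-≤ 1ℤ (ℤ.+-monoʳ-≤ (potential x) (-1≤potential s∈)) ⟩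
      1ℤ + (potential x + potential s) ≡⟨ cong (_+_ 1ℤ) (trans (potential-cong y≈x∙s) (potential-∙ x s)) ⟨
      1ℤ + potential y                 ∎
      where
      open ℤ.≤-Reasoning
      open +-*-Solver

    potential-Reach : ∀ {x y k} → Reach _≈_ (CayleyAdj Γ S) x y k →
                      potential x ℤ.≤ + k + potential y
    potential-Reach {y = y} (here x≈y) =
      ℤ.≤-reflexive (trans (potential-cong x≈y) (sym (ℤ.+-identityˡ (potential y))))
    potential-Reach {x} {z} (step {v = y} {k = k} a p) = begin
      potential x                ≤⟨ potential-CayleyAdj {x} {y} a ⟩
      1ℤ + potential y           ≤⟨ ℤ.+-monoʳ-≤ 1ℤ (potential-Reach p) ⟩
      1ℤ + (+ k + potential z)   ≡⟨ ℤ.+-assoc 1ℤ (+ k) (potential z) ⟨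
      + suc k + potential z      ∎
      where open ℤ.≤-Reasoning

    -- The potential falls by at most `k` in `k` steps, and `potential (φ w)` is `f w` minus the
    -- constant `f r`, which cancels.
    Lipschitz-Reach : ∀ {u v k} → Reach _≈_ (CayleyAdj Γ S) (φ u) (φ v) k →
                      f u ℕ.≤ k ℕ.+ f v
    Lipschitz-Reach {u} {v} {k} p = ℤ.drop‿+≤+ (begin
      + f u                           ≡⟨ shift u ⟩
      potential (φ u) + + f r         ≤⟨ ℤ.+-monoˡ-≤ (+ f r) (potential-Reach p) ⟩
      + k + potential (φ v) + + f r   ≡⟨ ℤ.+-assoc (+ k) (potential (φ v)) (+ f r) ⟩
      + k + (potential (φ v) + + f r) ≡⟨ cong (_+_ (+ k)) (shift v) ⟨
      + k + + f v                     ∎)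
      where
      open ℤ.≤-Reasoning
      open +-*-Solver
      shift : ∀ w → + f w ≡ potential (φ w) + + f r
      shift w = trans (solve 2 (λ a b → a := (a :- b) :+ b) refl (+ f w) (+ f r))
                      (cong (_+ + f r) (sym (potential-∂ (φ w) (∂-label (conn r w)))))

  φ-isometric : IsIsometric G Γ S φ
  φ-isometric u v = dist u v , proj₂ (distance u v) ,
    φ-Reach (proj₁ (proj₂ (distance u v))) , λ k p →
    -- With `f` the distance to `v`, the term `f v` is zero and the bound becomes `dist u v ≤ k`.
    subst (dist u v ℕ.≤_) (trans (cong (k ℕ.+_) (dist-self v)) (ℕ.+-identityʳ k))
      (Lipschitz-Reach (λ w → dist w v) (dist-Lipschitz v) p)

-- Isometry is proved in the universal group, then carried along `ψ` together with the generators to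
-- the host `ℤ^ (n ∸ 1)`. The truncated subtraction is exact, since the root `r` forces `n` to be
-- positive.
lemma4 :
    (G : Graph) (conn : Graph.Connected G) (o : Orientation G)
    (B : CycleBasis o) (r : Graph.V G) →
    let P = allSingleton G o
        Γ = Γ-univ P B
        Δ = ℤ^ (Graph.n G ∸ 1)
        S = connectionSet P B
        φ = quotientLabeling P B conn r
    in Σ[ ψ ∈ (AbelianGroup.Carrier Γ → AbelianGroup.Carrier Δ) ]
         IsIsomorphism Γ Δ ψ ×
         IsIsometric G Γ S φ ×
         IsIsometric G Δ (image Γ Δ ψ S) (ψ ∘ φ)
lemma4 G conn o B r =
  ψ conn o B r , ψ-isIsomorphism conn o B r , φ-isometric conn o B r ,
  mono-IsIsometric Γ Δ
    (GroupMorphisms.IsGroupIsomorphism.isGroupMonomorphism (ψ-isIsomorphism conn o B r))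
    (λ { x≈y (j , g≉ε , x≈g) → j , g≉ε , AbelianGroup.trans Γ (AbelianGroup.sym Γ x≈y) x≈g })
    G (φ-isometric conn o B r)
  where
  Γ = Γ-univ (allSingleton G o) B
  Δ = ℤ^ (Graph.n G ∸ 1)
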